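{- Let $\mathcal E=\{X_i=E_i\}_{i\in I}$ be a guarded system of equations in the Internal $\pi$-calculus whose syntactic solution has no divergences. If $\tilde F$ is a post-fixed point for $\sqsubseteq_{\mathrm{tr}}$ of $\mathcal E$ and $\tilde G$ is a pre-fixed point for $\sqsubseteq_{\mathrm{tr}}$ of $\mathcal E$, then $\tilde F\sqsubseteq_{\mathrm{tr}}\tilde G$.
   Context: Internal $\pi$-calculus: polyadic, well-sorted $\pi$-calculus with processes $P ::= 0\mid a(\tilde b).P\mid \overline a(\tilde b).P\mid(\nu a)P\mid P|P\mid\ !a(\tilde b).P\mid F\langle\tilde a\rangle$, abstractions $F::=(\tilde a)P\mid K$ (constants $K\triangleq(\tilde x)P$ with $P$ name-closed); all outputs bound, tuple components pairwise distinct; standard ground labelled transition system. For a sequence $s$ of visible actions $\mu_1,\dots,\mu_n$, $P\overset{s}{\Longrightarrow}$ if $P\overset{\mu_1}{\Longrightarrow}\cdots\overset{\mu_n}{\Longrightarrow}P_n$. $P\sqsubseteq_{\mathrm{tr}}Q$ if $P\overset{s}{\Longrightarrow}$ implies $Q\overset{s}{\Longrightarrow}$ for all $s$; extended to abstractions via fresh names, and to tuples componentwise. A process $P$ diverges if it has an infinite sequence of transitions that from some point on are all $\tau$; an abstraction diverges if its application to fresh names does. Expressions $E$ are name-closed abstractions possibly containing applications $X\langle\tilde a\rangle$ of equation variables. A system $\{X_i=E_i\}_{i\in I}$ ($I$ countable) is guarded if every occurrence of a variable in each $E_i$ is underneath a prefix. $E[\tilde F]$ replaces each $X_i$ by $F_i$.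 Syntactic solution: constants $K_{\mathcal E,i}\triangleq E_i[\tilde K_{\mathcal E}]$. $\tilde F$ is a pre-fixed point for $\sqsubseteq_{\mathrm{tr}}$ if $E_i[\tilde F]\sqsubseteq_{\mathrm{tr}}F_i$ for all $i$, and a post-fixed point if $F_i\sqsubseteq_{\mathrm{tr}}E_i[\tilde F]$ for all $i$. -}

module Defs where

open import Data.Empty using (⊥)
open import Data.List.Base using (List; []; _∷_; [_])
open import Data.List.Membership.Propositional using (_∈_)
open import Data.List.Relation.Unary.All as All using (All)
open import Data.List.Relation.Unary.Any using (here; there)
open import Data.Nat.Base using (ℕ; zero; suc)
open import Data.Product.Base using (∃; ∃₂; _×_; _,_)
open import Data.Sum.Base using (_⊎_; inj₁; inj₂; map₁) renaming ([_,_] to case⊎)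
open import Data.Unit.Base using (⊤)
open import Function.Base using (id; _∘_)
open import Function.Bundles using (_↣_)
open import Relation.Binary.Construct.Closure.ReflexiveTransitive using (Star)
open import Relation.Binary.PropositionalEquality using (_≡_; refl)
open import Relation.Nullary.Negation using (¬_)

-- A sorting in the sense of Milner: a name of sort s carries tuples of names
-- whose sorts are listed by  object s.
record Sorting : Set₁ where
  field
    Sort   : Set
    object : Sort → List Sort

module Calculus (𝒮 : Sorting) where
  open Sorting 𝒮

  -- Terms are taken up to α-conversion, by means of nested abstract syntax: a
  -- process is given over an arbitrary (possibly infinite) sorted set N of
  -- names, and binding a tuple of sorts σ moves to the disjoint union N ⊕ σ.
  -- Bound names are thereby fresh and pairwise distinct by construction.

  Names : Set₁
  Names = Sort → Set

  ∅ : {A : Set} → A → Set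
  ∅ _ = ⊥

  infixl 6 _⊕_
  _⊕_ : Names → List Sort → Names
  (N ⊕ σ) s = N s ⊎ s ∈ σ

  infix 4 _⇒_
  _⇒_ : Names → Names → Set
  N ⇒ M = ∀ s → N s → M s

  idʳ : ∀ {N} → N ⇒ N
  idʳ s = id

  wk : ∀ {N M σ} → N ⇒ M → N ⇒ M ⊕ σ
  wk ρ s = inj₁ ∘ ρ s

  lift : ∀ {N M σ} → N ⇒ M → N ⊕ σ ⇒ M ⊕ σ
  lift ρ s = map₁ (ρ s)

  closed : ∀ {N} → ∅ ⇒ N
  closed s ()

  Tuple : Names → List Sort → Set
  Tuple N σ = All N σ

  mapᵀ : ∀ {N M σ} → N ⇒ M → Tuple N σ → Tuple M σ
  mapᵀ ρ = All.map (ρ _)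

  -- Sends the bound names σ to the components of a tuple.
  inst : ∀ {N M σ} → N ⇒ M → Tuple M σ → N ⊕ σ ⇒ M
  inst ρ ã s = case⊎ (ρ s) (All.lookup ã)

  Distinct : ∀ {N : Names} {σ} → Tuple N σ → Set
  Distinct {σ = σ} ã =
    ∀ {s} (p q : s ∈ σ) → All.lookup ã p ≡ All.lookup ã q → p ≡ q

  -- Agent identifiers (constants or equation variables), classified by the
  -- sorts of their parameters.
  Signature : Set₁
  Signature = List Sort → Set

  data Polarity : Set where
    input output : Polarity

  -- Constants are drawn from C and equation variables from X.
  mutual
    data Term (C X : Signature) (N : Names) : Set where
      𝟘    : Term C X N
      pre  : ∀ {s} → Polarity → N s → Term C X (N ⊕ object s) → Term C X N
      ν    : ∀ s → Term C X (N ⊕ [ s ]) → Term C X N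
      _∥_  : Term C X N → Term C X N → Term C X N
      !inp : ∀ {s} → N s → Term C X (N ⊕ object s) → Term C X N
      _⟨_⟩ : ∀ {σ} → Agent C X N σ → Tuple N σ → Term C X N

    data Agent (C X : Signature) (N : Names) (σ : List Sort) : Set where
      abs : Term C X (N ⊕ σ) → Agent C X N σ
      con : C σ → Agent C X N σ
      var : X σ → Agent C X N σ

  Process : Signature → Names → Set
  Process C N = Term C ∅ N

  Abstraction : Signature → Names → List Sort → Set
  Abstraction C N σ = Agent C ∅ N σ

  mutual
    ren : ∀ {C X N M} → N ⇒ M → Term C X N → Term C X M
    ren ρ 𝟘           = 𝟘
    ren ρ (pre p a P) = pre p (ρ _ a) (ren (lift ρ) P)
    ren ρ (ν s P)     = ν s (ren (lift ρ) P)
    ren ρ (P ∥ Q)     = ren ρ P ∥ ren ρ Q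
    ren ρ (!inp a P)  = !inp (ρ _ a) (ren (lift ρ) P)
    ren ρ (F ⟨ ã ⟩)   = renᴬ ρ F ⟨ mapᵀ ρ ã ⟩

    renᴬ : ∀ {C X N M σ} → N ⇒ M → Agent C X N σ → Agent C X M σ
    renᴬ ρ (abs P) = abs (ren (lift ρ) P)
    renᴬ ρ (con k) = con k
    renᴬ ρ (var x) = var x

  -- P{ã/x̃}, where x̃ are the names bound by an abstraction (x̃)P.
  _⟦_⟧ : ∀ {C X N σ} → Term C X (N ⊕ σ) → Tuple N σ → Term C X N
  P ⟦ ã ⟧ = ren (inst idʳ ã) P

  applyFresh : ∀ {C X N σ} → Agent C X N σ → Term C X (N ⊕ σ)
  applyFresh F = renᴬ (wk idʳ) F ⟨ All.tabulate inj₂ ⟩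

  -- The convention that tuples have pairwise distinct components.  It has to
  -- survive the contraction of applied abstractions: ((x)X⟨x,c⟩)⟨c⟩ has the
  -- transitions of X⟨c,c⟩ and is not admitted.  So the names of a term are read
  -- through ρ, which records the arguments of the enclosing applications.
  mutual
    DistinctIn : ∀ {C X N M} → N ⇒ M → Term C X N → Set
    DistinctIn ρ 𝟘           = ⊤
    DistinctIn ρ (pre p a P) = DistinctIn (lift ρ) P
    DistinctIn ρ (ν s P)     = DistinctIn (lift ρ) P
    DistinctIn ρ (P ∥ Q)     = DistinctIn ρ P × DistinctIn ρ Q
    DistinctIn ρ (!inp a P)  = DistinctIn (lift ρ) P
    DistinctIn ρ (F ⟨ ã ⟩)   =
      Distinct (mapᵀ ρ ã) × DistinctInᴬ ρ F (mapᵀ ρ ã)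

    DistinctInᴬ : ∀ {C X N M σ} → N ⇒ M → Agent C X N σ → Tuple M σ → Set
    DistinctInᴬ ρ (abs P) ã = DistinctIn (inst ρ ã) P
    DistinctInᴬ ρ (con k) ã = ⊤
    DistinctInᴬ ρ (var x) ã = ⊤

  WellFormed : ∀ {C X N σ} → Agent C X N σ → Set
  WellFormed F = DistinctIn idʳ (applyFresh F)

  mutual
    data Guarded {C X : Signature} {N : Names} : Term C X N → Set where
      𝟘    : Guarded 𝟘
      pre  : ∀ {s p} {a : N s} {P} → Guarded (pre p a P)
      ν    : ∀ {s P} → Guarded P → Guarded (ν s P)
      _∥_  : ∀ {P Q} → Guarded P → Guarded Q → Guarded (P ∥ Q)
      !inp : ∀ {s} {a : N s} {P} → Guarded (!inp a P)
      app  : ∀ {σ} {F : Agent C X N σ} {ã} → Guardedᴬ F → Guarded (F ⟨ ã ⟩)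

    data Guardedᴬ {C X : Signature} {N : Names} {σ : List Sort} : Agent C X N σ → Set where
      abs : ∀ {P} → Guarded P → Guardedᴬ (abs P)
      con : ∀ {k} → Guardedᴬ (con k)

  -- Replaces every equation variable x by F x, without capture of the free
  -- names M of F, which θ embeds in the current scope.  Constants are carried
  -- along by κ to a possibly larger signature.
  mutual
    fill : ∀ {C D X M N} → (∀ {σ} → C σ → D σ) → (∀ {σ} → X σ → Abstraction D M σ) →
           M ⇒ N → Term C X N → Process D N
    fill κ F θ 𝟘           = 𝟘
    fill κ F θ (pre p a P) = pre p a (fill κ F (wk θ) P)
    fill κ F θ (ν s P)     = ν s (fill κ F (wk θ) P)
    fill κ F θ (P ∥ Q)     = fill κ F θ P ∥ fill κ F θ Q
    fill κ F θ (!inp a P)  = !inp a (fill κ F (wk θ) P)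
    fill κ F θ (A ⟨ ã ⟩)   = fillᴬ κ F θ A ⟨ ã ⟩

    fillᴬ : ∀ {C D X M N σ} → (∀ {σ} → C σ → D σ) → (∀ {σ} → X σ → Abstraction D M σ) →
            M ⇒ N → Agent C X N σ → Abstraction D N σ
    fillᴬ κ F θ (abs P) = abs (fill κ F (wk θ) P)
    fillᴬ κ F θ (con k) = con (κ k)
    fillᴬ κ F θ (var x) = renᴬ θ (F x)

  data Action (N : Names) : Set where
    τ   : Action N
    act : ∀ {s} → Polarity → N s → Action N

  -- The scope after an action: a visible action binds the transmitted names.
  _▹_ : (N : Names) → Action N → Names
  N ▹ τ             = N
  N ▹ act {s} p a = N ⊕ object s

  weaken : ∀ {C X N} (μ : Action N) → Term C X N → Term C X (N ▹ μ)
  weaken τ         P = P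
  weaken (act p a) P = ren (wk idʳ) P

  νs : ∀ {C X N} σ → Term C X (N ⊕ σ) → Term C X N
  νs []      P = ren (inst idʳ All.[]) P
  νs {N = N} (s ∷ σ) P = ν s (νs σ (ren split P))
    where
    split : N ⊕ (s ∷ σ) ⇒ N ⊕ [ s ] ⊕ σ
    split _ (inj₁ a)           = inj₁ (inj₁ a)
    split _ (inj₂ (here refl)) = inj₁ (inj₂ (here refl))
    split _ (inj₂ (there p))   = inj₂ p

  exchange : ∀ {N : Names} {σ σ′} → N ⊕ σ ⊕ σ′ ⇒ N ⊕ σ′ ⊕ σ
  exchange _ (inj₁ (inj₁ a)) = inj₁ (inj₁ a)
  exchange _ (inj₁ (inj₂ p)) = inj₂ p
  exchange _ (inj₂ q)        = inj₁ (inj₂ q)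

  -- Traces also bind: later actions may use the names bound by earlier ones.
  data Trace (N : Names) : Set where
    ε     : Trace N
    _·_∷_ : ∀ {s} → Polarity → N s → Trace (N ⊕ object s) → Trace N

  -- def k  is the name-closed abstraction defining the constant k.
  module Semantics {C : Signature} (def : ∀ {σ} → C σ → Abstraction C ∅ σ) where

    infix 4 _—[_]→_

    data _—[_]→_ {N : Names} : Process C N → (μ : Action N) → Process C (N ▹ μ) → Set where
      pre  : ∀ {s p} {a : N s} {P} → pre p a P —[ act p a ]→ P
      rep  : ∀ {s} {a : N s} {P} →
             !inp a P —[ act input a ]→ (P ∥ ren (wk idʳ) (!inp a P))
      parˡ : ∀ {P Q μ P′} → P —[ μ ]→ P′ → (P ∥ Q) —[ μ ]→ (P′ ∥ weaken μ Q)
      parʳ : ∀ {P Q μ Q′} → Q —[ μ ]→ Q′ → (P ∥ Q) —[ μ ]→ (weaken μ P ∥ Q′)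
      comˡ : ∀ {P Q s} {a : N s} {P′ Q′} →
             P —[ act input a ]→ P′ → Q —[ act output a ]→ Q′ →
             (P ∥ Q) —[ τ ]→ νs (object s) (P′ ∥ Q′)
      comʳ : ∀ {P Q s} {a : N s} {P′ Q′} →
             P —[ act output a ]→ P′ → Q —[ act input a ]→ Q′ →
             (P ∥ Q) —[ τ ]→ νs (object s) (P′ ∥ Q′)
      -- The side condition that the restricted name does not occur in the
      -- label is expressed by inj₁.
      resτ : ∀ {s P P′} → P —[ τ ]→ P′ → ν s P —[ τ ]→ ν s P′
      res  : ∀ {s s′ p} {a : N s′} {P P′} →
             P —[ act p (inj₁ a) ]→ P′ → ν s P —[ act p a ]→ ν s (ren exchange P′)
      abs  : ∀ {σ P} {ã : Tuple N σ} {μ P′} →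
             P ⟦ ã ⟧ —[ μ ]→ P′ → abs P ⟨ ã ⟩ —[ μ ]→ P′
      con  : ∀ {σ} {k : C σ} {ã : Tuple N σ} {μ P′} →
             renᴬ closed (def k) ⟨ ã ⟩ —[ μ ]→ P′ → con k ⟨ ã ⟩ —[ μ ]→ P′

    infix 4 _⟹_ _⟹[_·_]_ _⟹⟨_⟩ _⊑_ _⊑ᴬ_

    _⟹_ : ∀ {N} → Process C N → Process C N → Set
    _⟹_ = Star (λ P Q → P —[ τ ]→ Q)

    _⟹[_·_]_ : ∀ {N s} → Process C N → Polarity → N s → Process C (N ⊕ object s) → Set
    P ⟹[ p · a ] Q = ∃₂ λ P₁ Q₁ → P ⟹ P₁ × P₁ —[ act p a ]→ Q₁ × Q₁ ⟹ Q

    _⟹⟨_⟩ : ∀ {N} → Process C N → Trace N → Set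
    P ⟹⟨ ε ⟩         = ⊤
    P ⟹⟨ p · a ∷ t ⟩ = ∃ λ P′ → P ⟹[ p · a ] P′ × P′ ⟹⟨ t ⟩

    _⊑_ : ∀ {N} → Process C N → Process C N → Set
    P ⊑ Q = ∀ t → P ⟹⟨ t ⟩ → Q ⟹⟨ t ⟩

    _⊑ᴬ_ : ∀ {N σ} → Abstraction C N σ → Abstraction C N σ → Set
    F ⊑ᴬ G = applyFresh F ⊑ applyFresh G

    data Diverges {N : Names} (P : Process C N) : Set where
      τ^ω  : (f : ℕ → Process C N) → f zero ≡ P →
             (∀ n → f n —[ τ ]→ f (suc n)) → Diverges P
      step : ∀ {μ P′} → P —[ μ ]→ P′ → Diverges P′ → Diverges P

    Divergesᴬ : ∀ {N σ} → Abstraction C N σ → Set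
    Divergesᴬ F = Diverges (applyFresh F)

  -- The index set of the system is ∃ Var, the set of its variables.
  record System (C : Signature) : Set₁ where
    field
      Var        : Signature
      countable  : ∃ Var ↣ ℕ
      rhs        : ∀ {σ} → Var σ → Agent C Var ∅ σ
      wellFormed : ∀ {σ} (x : Var σ) → WellFormed (rhs x)

  IsGuarded : ∀ {C} → System C → Set
  IsGuarded ℰ = ∀ {σ} (x : Var σ) → Guardedᴬ (rhs x)
    where open System ℰ

  module Solutions {C : Signature} (def : ∀ {σ} → C σ → Abstraction C ∅ σ) (ℰ : System C) where
    open System ℰ

    -- The constants of C together with one constant K x = inj₂ x for each
    -- variable x of the system.
    C⁺ : Signature
    C⁺ σ = C σ ⊎ Var σ

    Family : Names → Set
    Family N = ∀ {σ} → Var σ → Abstraction C⁺ N σ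

    -- E x [ F ]  is  E_x[F̃].
    E_[_] : ∀ {N σ} → Var σ → Family N → Abstraction C⁺ N σ
    E x [ F ] = fillᴬ inj₁ F idʳ (renᴬ closed (rhs x))

    K : Family ∅
    K x = con (inj₂ x)

    def⁺ : ∀ {σ} → C⁺ σ → Abstraction C⁺ ∅ σ
    def⁺ (inj₁ k) = fillᴬ {D = C⁺} {X = ∅} {M = ∅} inj₁ (λ ()) idʳ (def k)
    def⁺ (inj₂ x) = E x [ K ]

    open Semantics def⁺ public

    DivergenceFree : Set
    DivergenceFree = ∀ {σ} (x : Var σ) → ¬ Divergesᴬ (K x)

    PostFixed : ∀ {N} → Family N → Set
    PostFixed F = ∀ {σ} (x : Var σ) → F x ⊑ᴬ E x [ F ]

    PreFixed : ∀ {N} → Family N → Set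
    PreFixed F = ∀ {σ} (x : Var σ) → E x [ F ] ⊑ᴬ F x

{-# OPTIONS --safe #-}
module Submission where

-- Let P, Q and R arise from one term by replacing its equation variables by F,
-- by the syntactic solution K and by G.  Unfolding the unguarded variables once
-- enlarges the traces of P (F is post-fixed) and shrinks those of R (G is
-- pre-fixed), since ⊑ is preserved by ν, ∥ and injective renaming; and K has
-- the transitions of its unfolding.  As the system is guarded, the first step
-- of the unfolded P is then a step of the term alone, which Q and R match, the
-- three residuals being again related.  Q does not diverge, so an induction on
-- the trace and on the well-founded τ-steps of Q shows P ⊑ R.

open import Defs
open import Axiom.ExcludedMiddle using (ExcludedMiddle)
open import Data.Bool.Base using (Bool; true; false)
open import Data.Empty using (⊥-elim)
open import Data.List.Base using (List; []; _∷_; [_])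
open import Data.List.Membership.Propositional using (_∈_)
open import Data.List.Relation.Unary.All as All using ([]; _∷_)
open import Data.List.Relation.Unary.All.Properties using (map-∘; map-cong; map-id; lookup-map)
open import Data.List.Relation.Unary.Any using (here; there)
open import Data.Nat.Base using (ℕ; zero; suc)
open import Data.Product.Base using (∃; ∃₂; _×_; _,_; proj₁; proj₂)
open import Data.Sum.Base using (inj₁; inj₂)
open import Data.Sum.Properties using (inj₁-injective; inj₂-injective)
open import Data.Unit.Base using (tt)
open import Function.Base using (_∘_)
open import Induction.WellFounded using (Acc; acc)
open import Level using (0ℓ)
open import Relation.Binary.Construct.Closure.ReflexiveTransitive using (ε; _◅_)
open import Relation.Binary.PropositionalEquality using (_≡_; _≢_; refl; sym; trans; cong; cong₂; subst; subst₂)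
open import Relation.Nullary.Decidable using (yes; no; decidable-stable)
open import Relation.Nullary.Negation using (¬_)

lookup-tabulate : {A : Set} {P : A → Set} {xs : List A} (f : ∀ {x} → x ∈ xs → P x)
  {x : A} (i : x ∈ xs) → All.lookup (All.tabulate {P = P} f) i ≡ f i
lookup-tabulate f (here refl) = refl
lookup-tabulate f (there i)   = lookup-tabulate (f ∘ there) i

-- Renamings and their action on terms.

module Renaming (𝒮 : Sorting) where
  open Sorting 𝒮
  open Calculus 𝒮

  Inj : ∀ {N M} → N ⇒ M → Set
  Inj {N} ρ = ∀ s {a b : N s} → ρ s a ≡ ρ s b → a ≡ b

  Disjoint : ∀ {N M L} → N ⇒ L → M ⇒ L → Set
  Disjoint {N} {M} ρ θ = ∀ s (a : N s) (b : M s) → ρ s a ≢ θ s b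

  infix 4 _⊙_≐_
  -- Composites are compared pointwise and `χ` is kept free, because two composed lifts agree with
  -- the lift of the composite only pointwise. In this form the laws below recurse under binders.
  _⊙_≐_ : ∀ {N M L} → M ⇒ L → N ⇒ M → N ⇒ L → Set
  _⊙_≐_ {N} ρ ξ χ = ∀ s (a : N s) → ρ s (ξ s a) ≡ χ s a

  lift-⊙ : ∀ {N M L σ} {ρ : M ⇒ L} {ξ : N ⇒ M} {χ : N ⇒ L} →
           ρ ⊙ ξ ≐ χ → lift {σ = σ} ρ ⊙ lift ξ ≐ lift χ
  lift-⊙ h s (inj₁ a) = cong inj₁ (h s a)
  lift-⊙ h s (inj₂ p) = refl

  lift-inj : ∀ {N M σ} {ρ : N ⇒ M} → Inj ρ → Inj (lift {σ = σ} ρ)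
  lift-inj i s {inj₁ a} {inj₁ b} e = cong inj₁ (i s (inj₁-injective e))
  lift-inj i s {inj₂ a} {inj₂ b} e = cong inj₂ (inj₂-injective e)

  wk-inj : ∀ {N M σ} {ρ : N ⇒ M} → Inj ρ → Inj (wk {σ = σ} ρ)
  wk-inj i s e = i s (inj₁-injective e)

  retract⇒inj : ∀ {N M} {ρ : N ⇒ M} (ψ : M ⇒ N) → ψ ⊙ ρ ≐ idʳ → Inj ρ
  retract⇒inj ψ h s e = trans (sym (h s _)) (trans (cong (ψ s) e) (h s _))

  exchange² : ∀ {N : Names} {σ σ′} → exchange ⊙ exchange {N} {σ} {σ′} ≐ idʳ
  exchange² s (inj₁ (inj₁ a)) = refl
  exchange² s (inj₁ (inj₂ p)) = refl
  exchange² s (inj₂ q)        = refl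

  exchange-inj : ∀ {N : Names} {σ σ′} → Inj (exchange {N} {σ} {σ′})
  exchange-inj = retract⇒inj exchange exchange²

  mapᵀ-⊙ : ∀ {N M L σ} {ρ : M ⇒ L} {ξ : N ⇒ M} {χ : N ⇒ L} →
           ρ ⊙ ξ ≐ χ → (ã : Tuple N σ) → mapᵀ ρ (mapᵀ ξ ã) ≡ mapᵀ χ ã
  mapᵀ-⊙ h ã = trans (map-∘ ã) (map-cong ã (h _))

  mutual
    ren-⊙ : ∀ {C X N M L} {ρ : M ⇒ L} {ξ : N ⇒ M} {χ : N ⇒ L} →
            ρ ⊙ ξ ≐ χ → (P : Term C X N) → ren ρ (ren ξ P) ≡ ren χ P
    ren-⊙ h 𝟘           = refl
    ren-⊙ h (pre p a P) = cong₂ (pre p) (h _ a) (ren-⊙ (lift-⊙ h) P)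
    ren-⊙ h (ν s P)     = cong (ν s) (ren-⊙ (lift-⊙ h) P)
    ren-⊙ h (P ∥ Q)     = cong₂ _∥_ (ren-⊙ h P) (ren-⊙ h Q)
    ren-⊙ h (!inp a P)  = cong₂ !inp (h _ a) (ren-⊙ (lift-⊙ h) P)
    ren-⊙ h (A ⟨ ã ⟩)   = cong₂ _⟨_⟩ (renᴬ-⊙ h A) (mapᵀ-⊙ h ã)

    renᴬ-⊙ : ∀ {C X N M L σ} {ρ : M ⇒ L} {ξ : N ⇒ M} {χ : N ⇒ L} →
             ρ ⊙ ξ ≐ χ → (A : Agent C X N σ) → renᴬ ρ (renᴬ ξ A) ≡ renᴬ χ A
    renᴬ-⊙ h (abs P) = cong abs (ren-⊙ (lift-⊙ h) P)
    renᴬ-⊙ h (con k) = refl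
    renᴬ-⊙ h (var x) = refl

  lift-id : ∀ {N σ} {ρ : N ⇒ N} → (∀ s a → ρ s a ≡ a) → ∀ s (a : (N ⊕ σ) s) → lift ρ s a ≡ a
  lift-id h s (inj₁ a) = cong inj₁ (h s a)
  lift-id h s (inj₂ p) = refl

  mutual
    ren-id : ∀ {C X N} {ρ : N ⇒ N} → (∀ s a → ρ s a ≡ a) → (P : Term C X N) → ren ρ P ≡ P
    ren-id h 𝟘           = refl
    ren-id h (pre p a P) = cong₂ (pre p) (h _ a) (ren-id (lift-id h) P)
    ren-id h (ν s P)     = cong (ν s) (ren-id (lift-id h) P)
    ren-id h (P ∥ Q)     = cong₂ _∥_ (ren-id h P) (ren-id h Q)
    ren-id h (!inp a P)  = cong₂ !inp (h _ a) (ren-id (lift-id h) P)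
    ren-id h (A ⟨ ã ⟩)   = cong₂ _⟨_⟩ (renᴬ-id h A) (trans (map-cong ã (h _)) (map-id ã))

    renᴬ-id : ∀ {C X N σ} {ρ : N ⇒ N} → (∀ s a → ρ s a ≡ a) → (A : Agent C X N σ) → renᴬ ρ A ≡ A
    renᴬ-id h (abs P) = cong abs (ren-id (lift-id h) P)
    renᴬ-id h (con k) = refl
    renᴬ-id h (var x) = refl

  ren-square : ∀ {C X N M M′ L} {ρ : M ⇒ L} {ξ : N ⇒ M} {ρ′ : M′ ⇒ L} {ξ′ : N ⇒ M′} →
               (∀ s a → ρ s (ξ s a) ≡ ρ′ s (ξ′ s a)) →
               (P : Term C X N) → ren ρ (ren ξ P) ≡ ren ρ′ (ren ξ′ P)
  ren-square h P = trans (ren-⊙ h P) (sym (ren-⊙ (λ _ _ → refl) P))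

  ren-cong : ∀ {C X N M} {ρ χ : N ⇒ M} → (∀ s a → ρ s a ≡ χ s a) →
             (P : Term C X N) → ren ρ P ≡ ren χ P
  ren-cong {ρ = ρ} h P = trans (cong (ren ρ) (sym (ren-id {ρ = idʳ} (λ _ _ → refl) P))) (ren-⊙ h P)

  ren-wk : ∀ {C X N M σ} (ρ : N ⇒ M) (P : Term C X N) →
           ren (lift {σ = σ} ρ) (ren (wk idʳ) P) ≡ ren (wk idʳ) (ren ρ P)
  ren-wk ρ = ren-square (λ _ _ → refl)

  inst-⊙ : ∀ {N M L σ} {ρ : M ⇒ L} {θ : N ⇒ M} {χ : N ⇒ L} → ρ ⊙ θ ≐ χ →
           (ã : Tuple M σ) → ρ ⊙ inst θ ã ≐ inst χ (mapᵀ ρ ã)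
  inst-⊙ h ã s (inj₁ a) = h s a
  inst-⊙ h ã s (inj₂ p) = sym (lookup-map ã p)

  inst-lift : ∀ {N M L σ} {θ : M ⇒ L} {ρ : N ⇒ M} {χ : N ⇒ L} → θ ⊙ ρ ≐ χ →
              (ã : Tuple L σ) → inst θ ã ⊙ lift ρ ≐ inst χ ã
  inst-lift h ã s (inj₁ a) = h s a
  inst-lift h ã s (inj₂ p) = refl

  -- Both sides rename `P` along `inst ρ (mapᵀ ρ ã)`.
  ren-⟦⟧ : ∀ {C X N M σ} (ρ : N ⇒ M) (P : Term C X (N ⊕ σ)) (ã : Tuple N σ) →
           ren ρ (P ⟦ ã ⟧) ≡ ren (lift ρ) P ⟦ mapᵀ ρ ã ⟧
  ren-⟦⟧ ρ P ã = trans (ren-⊙ (inst-⊙ (λ _ _ → refl) ã) P) (sym (ren-⊙ (inst-lift (λ _ _ → refl) (mapᵀ ρ ã)) P))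

  mapᵀ-tabulate : ∀ {N M σ} {ρ : N ⇒ M} {f : ∀ {s} → s ∈ σ → N s} (ã : Tuple M σ) →
                  (∀ {s} (p : s ∈ σ) → ρ s (f p) ≡ All.lookup ã p) → mapᵀ ρ (All.tabulate f) ≡ ã
  mapᵀ-tabulate []      h = refl
  mapᵀ-tabulate (a ∷ ã) h = cong₂ _∷_ (h (here refl)) (mapᵀ-tabulate ã (h ∘ there))

  -- Hypotheses on abstractions speak about fresh arguments; this equation carries them to actual
  -- arguments `ã` in a scope reached by `θ`.
  ren-applyFresh : ∀ {C X N M σ} (θ : N ⇒ M) (ã : Tuple M σ) (A : Agent C X N σ) →
                   ren (inst θ ã) (applyFresh A) ≡ renᴬ θ A ⟨ ã ⟩
  ren-applyFresh θ ã A = cong₂ _⟨_⟩ (renᴬ-⊙ (λ _ _ → refl) A) (mapᵀ-tabulate ã (λ _ → refl))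

  extrude : ∀ {N s σ} → N ⊕ (s ∷ σ) ⇒ N ⊕ [ s ] ⊕ σ
  extrude _ (inj₁ a)           = inj₁ (inj₁ a)
  extrude _ (inj₂ (here refl)) = inj₁ (inj₂ (here refl))
  extrude _ (inj₂ (there p))   = inj₂ p

  intrude : ∀ {N s σ} → N ⊕ [ s ] ⊕ σ ⇒ N ⊕ (s ∷ σ)
  intrude _ (inj₁ (inj₁ a))           = inj₁ a
  intrude _ (inj₁ (inj₂ (here refl))) = inj₂ (here refl)
  intrude _ (inj₂ p)                  = inj₂ (there p)

  intrude-extrude : ∀ {N s σ} → intrude ⊙ extrude {N} {s} {σ} ≐ idʳ
  intrude-extrude _ (inj₁ a)           = refl
  intrude-extrude _ (inj₂ (here refl)) = refl
  intrude-extrude _ (inj₂ (there p))   = refl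

  extrude-inj : ∀ {N s σ} → Inj (extrude {N} {s} {σ})
  extrude-inj = retract⇒inj intrude intrude-extrude

  -- `extrude` is a named copy of the renaming local to `νs`; the two agree pointwise.
  νs-∷ : ∀ {C X N} s σ (P : Term C X (N ⊕ (s ∷ σ))) → νs (s ∷ σ) P ≡ ν s (νs σ (ren extrude P))
  νs-∷ s σ P = cong (ν s ∘ νs σ) (ren-cong (λ where
    _ (inj₁ a) → refl
    _ (inj₂ (here refl)) → refl
    _ (inj₂ (there p)) → refl) P)

  ren-νs : ∀ {C X N M} (ρ : N ⇒ M) σ (P : Term C X (N ⊕ σ)) →
           ren ρ (νs σ P) ≡ νs σ (ren (lift ρ) P)
  ren-νs ρ []      P = ren-⟦⟧ ρ P []
  ren-νs ρ (s ∷ σ) P = trans (cong (ren ρ) (νs-∷ s σ P)) (trans (cong (ν s) (trans (ren-νs (lift ρ) σ _)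
    (cong (νs σ) (ren-square (λ where
      _ (inj₁ a) → refl
      _ (inj₂ (here refl)) → refl
      _ (inj₂ (there p)) → refl) P)))) (sym (νs-∷ s σ _)))

  -- Renaming of traces.

  renᵗ : ∀ {N M} → N ⇒ M → Trace N → Trace M
  renᵗ ρ ε           = ε
  renᵗ ρ (p · a ∷ t) = p · ρ _ a ∷ renᵗ (lift ρ) t

  renᵗ-⊙ : ∀ {N M L} {ρ : M ⇒ L} {ξ : N ⇒ M} {χ : N ⇒ L} →
           ρ ⊙ ξ ≐ χ → (t : Trace N) → renᵗ ρ (renᵗ ξ t) ≡ renᵗ χ t
  renᵗ-⊙ h ε           = refl
  renᵗ-⊙ h (p · a ∷ t) = cong₂ (p ·_∷_) (h _ a) (renᵗ-⊙ (lift-⊙ h) t)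

  renᵗ-id : ∀ {N} {ρ : N ⇒ N} → (∀ s a → ρ s a ≡ a) → (t : Trace N) → renᵗ ρ t ≡ t
  renᵗ-id h ε           = refl
  renᵗ-id h (p · a ∷ t) = cong₂ (p ·_∷_) (h _ a) (renᵗ-id (lift-id h) t)

  renᵗ-cong : ∀ {N M} {ρ χ : N ⇒ M} → (∀ s a → ρ s a ≡ χ s a) → (t : Trace N) → renᵗ ρ t ≡ renᵗ χ t
  renᵗ-cong {ρ = ρ} h t = trans (cong (renᵗ ρ) (sym (renᵗ-id {ρ = idʳ} (λ _ _ → refl) t))) (renᵗ-⊙ h t)

  renᵗ-square : ∀ {N M M′ L} {ρ : M ⇒ L} {ξ : N ⇒ M} {ρ′ : M′ ⇒ L} {ξ′ : N ⇒ M′} →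
                (∀ s a → ρ s (ξ s a) ≡ ρ′ s (ξ′ s a)) →
                (t : Trace N) → renᵗ ρ (renᵗ ξ t) ≡ renᵗ ρ′ (renᵗ ξ′ t)
  renᵗ-square h t = trans (renᵗ-⊙ h t) (sym (renᵗ-⊙ (λ _ _ → refl) t))

  -- Filling, distinctness and guardedness under renaming.

  mutual
    ren-fill : ∀ {C D X M N L} {κ : ∀ {σ} → C σ → D σ} {F : ∀ {σ} → X σ → Abstraction D M σ}
               {ρ : N ⇒ L} {θ : M ⇒ N} {χ : M ⇒ L} → ρ ⊙ θ ≐ χ → (P : Term C X N) →
               ren ρ (fill κ F θ P) ≡ fill κ F χ (ren ρ P)
    ren-fill h 𝟘           = refl
    ren-fill h (pre p a P) = cong (pre p _) (ren-fill (λ s a → cong inj₁ (h s a)) P)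
    ren-fill h (ν s P)     = cong (ν s) (ren-fill (λ s a → cong inj₁ (h s a)) P)
    ren-fill h (P ∥ Q)     = cong₂ _∥_ (ren-fill h P) (ren-fill h Q)
    ren-fill h (!inp a P)  = cong (!inp _) (ren-fill (λ s a → cong inj₁ (h s a)) P)
    ren-fill h (A ⟨ ã ⟩)   = cong (_⟨ _ ⟩) (renᴬ-fillᴬ h A)

    renᴬ-fillᴬ : ∀ {C D X M N L σ} {κ : ∀ {σ} → C σ → D σ} {F : ∀ {σ} → X σ → Abstraction D M σ}
                 {ρ : N ⇒ L} {θ : M ⇒ N} {χ : M ⇒ L} → ρ ⊙ θ ≐ χ → (A : Agent C X N σ) →
                 renᴬ ρ (fillᴬ κ F θ A) ≡ fillᴬ κ F χ (renᴬ ρ A)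
    renᴬ-fillᴬ h (abs P) = cong abs (ren-fill (λ s a → cong inj₁ (h s a)) P)
    renᴬ-fillᴬ h (con k) = refl
    renᴬ-fillᴬ {F = F} h (var x) = renᴬ-⊙ h (F x)

  inst-inj : ∀ {N M σ} {θ : N ⇒ M} (ã : Tuple M σ) → Inj θ → Distinct ã →
             (∀ s p b → All.lookup ã {s} p ≢ θ s b) → Inj (inst θ ã)
  inst-inj ã i d n s {inj₁ a} {inj₁ b} e = cong inj₁ (i s e)
  inst-inj ã i d n s {inj₁ a} {inj₂ q} e = ⊥-elim (n s q a (sym e))
  inst-inj ã i d n s {inj₂ p} {inj₁ b} e = ⊥-elim (n s p b e)
  inst-inj ã i d n s {inj₂ p} {inj₂ q} e = cong inj₂ (d p q e)

  mapᵀ-distinct : ∀ {N M σ} {ζ : N ⇒ M} → Inj ζ → (ã : Tuple N σ) → Distinct ã → Distinct (mapᵀ ζ ã)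
  mapᵀ-distinct i ã d p q e =
    d p q (i _ (trans (sym (lookup-map ã p)) (trans e (lookup-map ã q))))

  mutual
    -- Well-formedness reads a term at fresh parameters. An injective `ζ` keeps tuple components
    -- apart, so the property passes to actual arguments that are distinct.
    distinct-inj : ∀ {C X N M L} {ζ : M ⇒ L} {ρ : N ⇒ M} {χ : N ⇒ L} → Inj ζ → ζ ⊙ ρ ≐ χ →
                   (P : Term C X N) → DistinctIn ρ P → DistinctIn χ P
    distinct-inj i h 𝟘           d         = tt
    distinct-inj i h (pre p a P) d         = distinct-inj (lift-inj i) (lift-⊙ h) P d
    distinct-inj i h (ν s P)     d         = distinct-inj (lift-inj i) (lift-⊙ h) P d
    distinct-inj i h (P ∥ Q)     (d , e)   = distinct-inj i h P d , distinct-inj i h Q e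
    distinct-inj i h (!inp a P)  d         = distinct-inj (lift-inj i) (lift-⊙ h) P d
    distinct-inj {χ = χ} i h (A ⟨ ã ⟩) (d , e) =
      subst (λ b̃ → Distinct b̃ × DistinctInᴬ χ A b̃) (mapᵀ-⊙ h ã) (mapᵀ-distinct i (mapᵀ _ ã) d , distinctᴬ-inj i h A e)

    distinctᴬ-inj : ∀ {C X N M L σ} {ζ : M ⇒ L} {ρ : N ⇒ M} {χ : N ⇒ L} → Inj ζ → ζ ⊙ ρ ≐ χ →
                    (A : Agent C X N σ) {b̃ : Tuple M σ} → DistinctInᴬ ρ A b̃ → DistinctInᴬ χ A (mapᵀ ζ b̃)
    distinctᴬ-inj i h (abs P) {b̃} d = distinct-inj i (inst-⊙ h b̃) P d
    distinctᴬ-inj i h (con k) d = tt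
    distinctᴬ-inj i h (var x) d = tt

  mutual
    guarded-ren : ∀ {C X N M} (ρ : N ⇒ M) {P : Term C X N} → Guarded P → Guarded (ren ρ P)
    guarded-ren ρ 𝟘       = 𝟘
    guarded-ren ρ pre     = pre
    guarded-ren ρ (ν g)   = ν (guarded-ren (lift ρ) g)
    guarded-ren ρ (g ∥ h) = guarded-ren ρ g ∥ guarded-ren ρ h
    guarded-ren ρ !inp    = !inp
    guarded-ren ρ (app g) = app (guardedᴬ-ren ρ g)

    guardedᴬ-ren : ∀ {C X N M σ} (ρ : N ⇒ M) {A : Agent C X N σ} → Guardedᴬ A → Guardedᴬ (renᴬ ρ A)
    guardedᴬ-ren ρ (abs g) = abs (guarded-ren (lift ρ) g)
    guardedᴬ-ren ρ con     = con

-- Transitions under renaming.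

module Transitions (𝒮 : Sorting) {C : Calculus.Signature 𝒮}
  (def : ∀ {σ} → C σ → Calculus.Abstraction 𝒮 C (Calculus.∅ 𝒮) σ) where
  open Sorting 𝒮
  open Calculus 𝒮
  open Renaming 𝒮
  open Semantics def

  ren-def : ∀ {N M σ} (ρ : N ⇒ M) (k : C σ) (ã : Tuple N σ) →
            ren ρ (renᴬ closed (def k) ⟨ ã ⟩) ≡ renᴬ closed (def k) ⟨ mapᵀ ρ ã ⟩
  ren-def ρ k ã = cong (_⟨ mapᵀ ρ ã ⟩) (renᴬ-⊙ (λ _ ()) (def k))

  private
    castˡ : ∀ {N} {P P′ : Process C N} {μ R} → P ≡ P′ → P —[ μ ]→ R → P′ —[ μ ]→ R
    castˡ refl d = d

    castʳ : ∀ {N} {P : Process C N} {μ R R′} → R ≡ R′ → P —[ μ ]→ R → P —[ μ ]→ R′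
    castʳ refl d = d

    ren-exchange : ∀ {N M σ σ′} (ρ : N ⇒ M) (P : Process C (N ⊕ σ ⊕ σ′)) →
                   ren exchange (ren (lift (lift ρ)) P) ≡ ren (lift (lift ρ)) (ren exchange P)
    ren-exchange ρ = ren-square λ where
      _ (inj₁ (inj₁ a)) → refl
      _ (inj₁ (inj₂ p)) → refl
      _ (inj₂ q)        → refl

  mutual
    ren-τ : ∀ {N M} (ρ : N ⇒ M) {P P′ : Process C N} → P —[ τ ]→ P′ → ren ρ P —[ τ ]→ ren ρ P′
    ren-τ ρ (parˡ d)   = parˡ (ren-τ ρ d)
    ren-τ ρ (parʳ d)   = parʳ (ren-τ ρ d)
    ren-τ ρ (comˡ {s = s} d e) = castʳ (sym (ren-νs ρ (object s) _)) (comˡ (ren-act ρ d) (ren-act ρ e))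
    ren-τ ρ (comʳ {s = s} d e) = castʳ (sym (ren-νs ρ (object s) _)) (comʳ (ren-act ρ d) (ren-act ρ e))
    ren-τ ρ (resτ d)   = resτ (ren-τ (lift ρ) d)
    ren-τ ρ (abs {P = P} {ã = ã} d) = abs (castˡ (ren-⟦⟧ ρ P ã) (ren-τ ρ d))
    ren-τ ρ (con {k = k} {ã = ã} d) = con (castˡ (ren-def ρ k ã) (ren-τ ρ d))

    ren-act : ∀ {N M} (ρ : N ⇒ M) {P : Process C N} {s p} {a : N s} {P′} →
              P —[ act p a ]→ P′ → ren ρ P —[ act p (ρ s a) ]→ ren (lift ρ) P′
    ren-act ρ pre = pre
    ren-act ρ (rep {P = P}) = castʳ (cong (ren (lift ρ) P ∥_) (sym (ren-wk ρ (!inp _ P)))) rep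
    ren-act ρ (parˡ {Q = Q} d) = castʳ (cong (_ ∥_) (sym (ren-wk ρ Q))) (parˡ (ren-act ρ d))
    ren-act ρ (parʳ {P = P} d) = castʳ (cong (_∥ _) (sym (ren-wk ρ P))) (parʳ (ren-act ρ d))
    ren-act ρ (res {P′ = P′} d) = castʳ (cong (ν _) (ren-exchange ρ P′)) (res (ren-act (lift ρ) d))
    ren-act ρ (abs {P = P} {ã = ã} d) = abs (castˡ (ren-⟦⟧ ρ P ã) (ren-act ρ d))
    ren-act ρ (con {k = k} {ã = ã} d) = con (castˡ (ren-def ρ k ã) (ren-act ρ d))

  -- The source is only propositionally a renamed term, so that the recursion
  -- stays structural in the derivation when an application is contracted.
  mutual
    unren-τ : ∀ {N M} {ρ : N ⇒ M} → Inj ρ → ∀ (P : Process C N) {S R} → S ≡ ren ρ P →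
              S —[ τ ]→ R → ∃ λ P′ → P —[ τ ]→ P′ × R ≡ ren ρ P′
    unren-τ i (P ∥ Q) refl (parˡ d) with unren-τ i P refl d
    ... | _ , d′ , refl = _ , parˡ d′ , refl
    unren-τ i (P ∥ Q) refl (parʳ d) with unren-τ i Q refl d
    ... | _ , d′ , refl = _ , parʳ d′ , refl
    unren-τ i (P ∥ Q) refl (comˡ {s = s} d e) with unren-act i P refl d | unren-act i Q refl e
    -- The two channels have the same image under `ρ`; injectivity identifies them, so the
    -- communication already exists before renaming.
    ... | a , _ , h , d′ , refl | b , _ , h′ , e′ , refl with i _ {a} {b} (trans (sym h) h′)
    ... | refl = _ , comˡ d′ e′ , sym (ren-νs _ (object s) _)
    unren-τ i (P ∥ Q) refl (comʳ {s = s} d e) with unren-act i P refl d | unren-act i Q refl e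
    ... | a , _ , h , d′ , refl | b , _ , h′ , e′ , refl with i _ {a} {b} (trans (sym h) h′)
    ... | refl = _ , comʳ d′ e′ , sym (ren-νs _ (object s) _)
    unren-τ i (ν s P) refl (resτ d) with unren-τ (lift-inj i) P refl d
    ... | _ , d′ , refl = _ , resτ d′ , refl
    unren-τ i (abs P ⟨ ã ⟩) refl (abs d) with unren-τ i (P ⟦ ã ⟧) (sym (ren-⟦⟧ _ P ã)) d
    ... | _ , d′ , refl = _ , abs d′ , refl
    unren-τ i (con k ⟨ ã ⟩) refl (con d)
      with unren-τ i (renᴬ closed (def k) ⟨ ã ⟩) (sym (ren-def _ k ã)) d
    ... | _ , d′ , refl = _ , con d′ , refl

    unren-act : ∀ {N M} {ρ : N ⇒ M} → Inj ρ → ∀ (P : Process C N) {S s p} {b : M s} {R} →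
                S ≡ ren ρ P → S —[ act p b ]→ R →
                ∃₂ λ a P′ → b ≡ ρ s a × P —[ act p a ]→ P′ × R ≡ ren (lift ρ) P′
    unren-act i (pre p a P) refl pre = _ , _ , refl , pre , refl
    unren-act {ρ = ρ} i (!inp a P) refl rep =
      _ , _ , refl , rep , cong (ren (lift ρ) P ∥_) (sym (ren-wk _ (!inp a P)))
    unren-act i (P ∥ Q) refl (parˡ d) with unren-act i P refl d
    ... | _ , _ , refl , d′ , refl = _ , _ , refl , parˡ d′ , cong (_ ∥_) (sym (ren-wk _ Q))
    unren-act i (P ∥ Q) refl (parʳ d) with unren-act i Q refl d
    ... | _ , _ , refl , d′ , refl = _ , _ , refl , parʳ d′ , cong (_∥ _) (sym (ren-wk _ P))
    unren-act i (ν s P) refl (res d) with unren-act (lift-inj i) P refl d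
    -- The label is an `inj₁`, whereas `lift ρ` sends the restricted name to an `inj₂`; hence this
    -- is the only possible preimage.
    ... | inj₁ a , P′ , refl , d′ , refl = _ , _ , refl , res d′ , cong (ν s) (ren-exchange _ P′)
    unren-act i (abs P ⟨ ã ⟩) refl (abs d) with unren-act i (P ⟦ ã ⟧) (sym (ren-⟦⟧ _ P ã)) d
    ... | _ , _ , refl , d′ , refl = _ , _ , refl , abs d′ , refl
    unren-act i (con k ⟨ ã ⟩) refl (con d)
      with unren-act i (renᴬ closed (def k) ⟨ ã ⟩) (sym (ren-def _ k ã)) d
    ... | _ , _ , refl , d′ , refl = _ , _ , refl , con d′ , refl

  -- Weak traces as runs, and runs under restriction.

  -- A weak trace presented step by step; the number of steps is the measure of
  -- the inductions that rearrange a run.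
  data Run {N : Names} : ℕ → Process C N → Trace N → Set where
    done : ∀ {P} → Run zero P ε
    tau  : ∀ {n P P′ t} → P —[ τ ]→ P′ → Run n P′ t → Run (suc n) P t
    vis  : ∀ {n P s p} {a : N s} {P′ t} → P —[ act p a ]→ P′ → Run n P′ t → Run (suc n) P (p · a ∷ t)

  run⇒weak : ∀ {n N} {P : Process C N} {t} → Run n P t → P ⟹⟨ t ⟩
  run⇒weak {t = ε} r = tt
  run⇒weak {t = p · a ∷ t} (tau d r) with run⇒weak r
  ... | _ , (_ , _ , ds , e , es) , h = _ , (_ , _ , d ◅ ds , e , es) , h
  run⇒weak (vis d r) = _ , (_ , _ , ε , d , ε) , run⇒weak r

  weak⇒run : ∀ {N} {P : Process C N} t → P ⟹⟨ t ⟩ → ∃ λ n → Run n P t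
  weak⇒run ε h = _ , done
  weak⇒run (p · a ∷ t) (_ , (_ , _ , ds , e , es) , h) =
    taus ds (_ , vis e (proj₂ (taus es (weak⇒run t h))))
    where
    taus : ∀ {N} {P Q : Process C N} {t} → P ⟹ Q → (∃ λ n → Run n Q t) → ∃ λ n → Run n P t
    taus ε        r = r
    taus (d ◅ ds) r = _ , tau d (proj₂ (taus ds r))

  run-ren : ∀ {n N M} (ρ : N ⇒ M) {P : Process C N} {t} → Run n P t → Run n (ren ρ P) (renᵗ ρ t)
  run-ren ρ done      = done
  run-ren ρ (tau d r) = tau (ren-τ ρ d) (run-ren ρ r)
  run-ren ρ (vis d r) = vis (ren-act ρ d) (run-ren (lift ρ) r)

  -- Every subject in `u` lies in the image of `ρ` or is bound earlier in `u`, so the trace can be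
  -- pulled back along with the run.
  run-unren : ∀ {n N M} {ρ : N ⇒ M} → Inj ρ → ∀ {P : Process C N} {u} → Run n (ren ρ P) u →
              ∃ λ t → u ≡ renᵗ ρ t × Run n P t
  run-unren i done = ε , refl , done
  run-unren i {P} (tau d r) with unren-τ i P refl d
  ... | _ , d′ , refl with run-unren i r
  ... | t , refl , r′ = t , refl , tau d′ r′
  run-unren i {P} (vis d r) with unren-act i P refl d
  ... | _ , _ , refl , d′ , refl with run-unren (lift-inj i) r
  ... | t , refl , r′ = _ , refl , vis d′ r′

  run-cast : ∀ {n N} {P Q : Process C N} {t u} → P ≡ Q → t ≡ u → Run n P t → Run n Q u
  run-cast refl refl r = r

  run-ν⁺ : ∀ {n N s} {P : Process C (N ⊕ [ s ])} (t : Trace N) →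
           Run n P (renᵗ (wk idʳ) t) → Run n (ν s P) t
  run-ν⁺ ε           done      = done
  run-ν⁺ t           (tau d r) = tau (resτ d) (run-ν⁺ t r)
  run-ν⁺ (p · a ∷ t) (vis d r) =
    vis (res d) (run-ν⁺ t (run-cast refl (renᵗ-⊙ (λ where
      _ (inj₁ a) → refl
      _ (inj₂ p) → refl) t) (run-ren exchange r)))

  run-ν⁻ : ∀ {n N s} {P : Process C (N ⊕ [ s ])} {t : Trace N} →
           Run n (ν s P) t → Run n P (renᵗ (wk idʳ) t)
  run-ν⁻ done             = done
  run-ν⁻ (tau (resτ d) r) = tau d (run-ν⁻ r)
  run-ν⁻ {t = p · a ∷ t} (vis (res {P′ = P′} d) r) =
    -- `res` leaves `ren exchange P′` under the restriction. As `exchange` is an involution,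
    -- renaming the run by it once more gives a run of `P′`.
    vis d (run-cast (trans (ren-⊙ exchange² P′) (ren-id (λ _ _ → refl) P′))
      (trans (renᵗ-⊙ (λ _ _ → refl) t) (sym (renᵗ-cong (λ where
      _ (inj₁ a) → refl
      _ (inj₂ p) → refl) t))) (run-ren exchange (run-ν⁻ r)))

  run-νs⁺ : ∀ {n N} σ {P : Process C (N ⊕ σ)} (t : Trace N) →
            Run n P (renᵗ (wk idʳ) t) → Run n (νs σ P) t
  run-νs⁺ [] t r = run-cast refl (trans (renᵗ-⊙ (λ _ _ → refl) t) (renᵗ-id (λ _ _ → refl) t))
    (run-ren (inst idʳ []) r)
  run-νs⁺ (s ∷ σ) {P} t r = run-cast (sym (νs-∷ s σ P)) refl
    (run-ν⁺ t (run-νs⁺ σ (renᵗ (wk idʳ) t)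
      (run-cast refl (renᵗ-square (λ _ _ → refl) t) (run-ren extrude r))))

  -- The length is kept exactly: `run-split` opens the restriction left by a communication in this
  -- way and recurses on `n`.
  run-νs⁻ : ∀ {n N} σ {P : Process C (N ⊕ σ)} (t : Trace N) →
            Run n (νs σ P) t → Run n P (renᵗ (wk idʳ) t)
  run-νs⁻ [] {P} t r = run-cast
    (trans (ren-⊙ {χ = idʳ} (λ where
      _ (inj₁ a) → refl
      _ (inj₂ ())) P) (ren-id (λ _ _ → refl) P)) refl (run-ren (wk idʳ) r)
  run-νs⁻ (s ∷ σ) {P} t r = run-cast
    (trans (ren-⊙ intrude-extrude P) (ren-id (λ _ _ → refl) P))
    (trans (cong (renᵗ intrude) (renᵗ-⊙ (λ _ _ → refl) t)) (renᵗ-⊙ (λ _ _ → refl) t))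
    (run-ren intrude (run-νs⁻ σ (renᵗ (wk idʳ) t) (run-ν⁻ (run-cast (νs-∷ s σ P) refl r))))

  -- Runs of parallel compositions.

  -- No scope for communicated names is needed: t is a trace of νs σ P exactly if
  -- its weakening is a trace of P, so a communication just weakens the result.
  data Merge {N : Names} : Trace N → Trace N → Trace N → Set where
    ε     : Merge ε ε ε
    left  : ∀ {s p} {a : N s} {t₁ t₂ t} → Merge t₁ (renᵗ (wk idʳ) t₂) t →
            Merge (p · a ∷ t₁) t₂ (p · a ∷ t)
    right : ∀ {s p} {a : N s} {t₁ t₂ t} → Merge (renᵗ (wk idʳ) t₁) t₂ t →
            Merge t₁ (p · a ∷ t₂) (p · a ∷ t)
    comˡ  : ∀ {s} {a : N s} {t₁ t₂ t} → Merge t₁ t₂ (renᵗ (wk idʳ) t) →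
            Merge (input · a ∷ t₁) (output · a ∷ t₂) t
    comʳ  : ∀ {s} {a : N s} {t₁ t₂ t} → Merge t₁ t₂ (renᵗ (wk idʳ) t) →
            Merge (output · a ∷ t₁) (input · a ∷ t₂) t

  run-split : ∀ {n N} {P Q : Process C N} {t} → Run n (P ∥ Q) t →
              ∃₂ λ t₁ t₂ → (∃ λ m → Run m P t₁) × (∃ λ m → Run m Q t₂) × Merge t₁ t₂ t
  run-split done = _ , _ , (_ , done) , (_ , done) , ε
  run-split (tau (parˡ d) r) with run-split r
  ... | _ , _ , (_ , r₁) , r₂ , m = _ , _ , (_ , tau d r₁) , r₂ , m
  run-split (tau (parʳ d) r) with run-split r
  ... | _ , _ , r₁ , (_ , r₂) , m = _ , _ , r₁ , (_ , tau d r₂) , m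
  run-split {t = t} (tau (comˡ {s = s} d e) r) with run-split (run-νs⁻ (object s) t r)
  ... | _ , _ , (_ , r₁) , (_ , r₂) , m = _ , _ , (_ , vis d r₁) , (_ , vis e r₂) , comˡ m
  run-split {t = t} (tau (comʳ {s = s} d e) r) with run-split (run-νs⁻ (object s) t r)
  ... | _ , _ , (_ , r₁) , (_ , r₂) , m = _ , _ , (_ , vis d r₁) , (_ , vis e r₂) , comʳ m
  run-split (vis (parˡ d) r) with run-split r
  -- The idle component was weakened by the action; its run is pulled back to the scope before that
  -- action.
  ... | _ , _ , (_ , r₁) , (_ , r₂) , m with run-unren (wk-inj (λ _ e → e)) r₂
  ... | _ , refl , r₂′ = _ , _ , (_ , vis d r₁) , (_ , r₂′) , left m
  run-split (vis (parʳ d) r) with run-split r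
  ... | _ , _ , (_ , r₁) , (_ , r₂) , m with run-unren (wk-inj (λ _ e → e)) r₁
  ... | _ , refl , r₁′ = _ , _ , (_ , r₁′) , (_ , vis d r₂) , right m

  -- The recursion is on the merge first and on the two runs second: silent steps of a component are
  -- performed until the visible action that the merge demands comes up.
  run-merge : ∀ {N t₁ t₂ t} → Merge t₁ t₂ t → ∀ {n₁ n₂} {P Q : Process C N} →
              Run n₁ P t₁ → Run n₂ Q t₂ → ∃ λ n → Run n (P ∥ Q) t
  run-merge ε r₁ r₂ = _ , done
  run-merge (left m) (tau d r₁) r₂ = _ , tau (parˡ d) (proj₂ (run-merge (left m) r₁ r₂))
  run-merge (left m) (vis d r₁) r₂ = _ , vis (parˡ d) (proj₂ (run-merge m r₁ (run-ren (wk idʳ) r₂)))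
  run-merge (right m) r₁ (tau d r₂) = _ , tau (parʳ d) (proj₂ (run-merge (right m) r₁ r₂))
  run-merge (right m) r₁ (vis d r₂) = _ , vis (parʳ d) (proj₂ (run-merge m (run-ren (wk idʳ) r₁) r₂))
  run-merge m@(comˡ _) (tau d r₁) r₂ = _ , tau (parˡ d) (proj₂ (run-merge m r₁ r₂))
  run-merge m@(comˡ _) r₁@(vis _ _) (tau d r₂) = _ , tau (parʳ d) (proj₂ (run-merge m r₁ r₂))
  run-merge {t = t} (comˡ {s} m) (vis d r₁) (vis e r₂) =
    _ , tau (comˡ d e) (run-νs⁺ (object s) t (proj₂ (run-merge m r₁ r₂)))
  run-merge m@(comʳ _) (tau d r₁) r₂ = _ , tau (parˡ d) (proj₂ (run-merge m r₁ r₂))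
  run-merge m@(comʳ _) r₁@(vis _ _) (tau d r₂) = _ , tau (parʳ d) (proj₂ (run-merge m r₁ r₂))
  run-merge {t = t} (comʳ {s} m) (vis d r₁) (vis e r₂) =
    _ , tau (comʳ d e) (run-νs⁺ (object s) t (proj₂ (run-merge m r₁ r₂)))

  -- Precongruence properties of the trace preorder.

  ⊑-ν : ∀ {N s} {P Q : Process C (N ⊕ [ s ])} → P ⊑ Q → ν s P ⊑ ν s Q
  ⊑-ν h t w = run⇒weak (run-ν⁺ t (proj₂
    (weak⇒run _ (h _ (run⇒weak (run-ν⁻ (proj₂ (weak⇒run t w))))))))

  ⊑-∥ : ∀ {N} {P P′ Q Q′ : Process C N} → P ⊑ P′ → Q ⊑ Q′ → (P ∥ Q) ⊑ (P′ ∥ Q′)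
  ⊑-∥ h h′ t w with run-split (proj₂ (weak⇒run t w))
  ... | t₁ , t₂ , (_ , r₁) , (_ , r₂) , m = run⇒weak (proj₂ (run-merge m
    (proj₂ (weak⇒run _ (h t₁ (run⇒weak r₁)))) (proj₂ (weak⇒run _ (h′ t₂ (run⇒weak r₂))))))

  -- A run of `ren ρ P` is pulled back to `P`, matched in `Q` and pushed forward again. Injectivity
  -- excludes communications that would arise from identifying names.
  ⊑-ren : ∀ {N M} {ρ : N ⇒ M} → Inj ρ → {P Q : Process C N} → P ⊑ Q → ren ρ P ⊑ ren ρ Q
  ⊑-ren {ρ = ρ} i h u w with run-unren i (proj₂ (weak⇒run u w))
  ... | t , refl , r = run⇒weak (run-ren ρ (proj₂ (weak⇒run t (h t (run⇒weak r)))))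

  -- A nonempty trace takes at least one step, and only the first has to be transferred since the
  -- residuals coincide.
  steps⇒⊑ : ∀ {N} {P Q : Process C N} → (∀ {μ P′} → P —[ μ ]→ P′ → Q —[ μ ]→ P′) → P ⊑ Q
  steps⇒⊑ h ε w = tt
  steps⇒⊑ h t@(_ · _ ∷ _) w with weak⇒run t w
  ... | _ , tau d r = run⇒weak (tau (h d) r)
  ... | _ , vis d r = run⇒weak (vis (h d) r)

  -- Divergence and well-foundedness of silent steps.

  diverges-unren : ∀ {N M} {ρ : N ⇒ M} → Inj ρ → ∀ {P : Process C N} → Diverges (ren ρ P) → Diverges P
  diverges-unren {ρ = ρ} i {P} (τ^ω f f₀ steps) = τ^ω (proj₁ ∘ g) refl λ n → proj₁ (proj₂ (next n (g n)))
    where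
    Preimage : ℕ → Set
    Preimage n = ∃ λ P → f n ≡ ren ρ P

    next : ∀ n (p : Preimage n) → ∃ λ P′ → proj₁ p —[ τ ]→ P′ × f (suc n) ≡ ren ρ P′
    next n (P , e) = unren-τ i P e (steps n)

    g : ∀ n → Preimage n
    g zero    = P , f₀
    g (suc n) with next n (g n)
    ... | P′ , _ , e = P′ , e
  diverges-unren i {P} (step {τ} d D) with unren-τ i P refl d
  ... | _ , d′ , refl = step d′ (diverges-unren i D)
  diverges-unren i {P} (step {act p b} d D) with unren-act i P refl d
  ... | _ , _ , refl , d′ , refl = step d′ (diverges-unren (lift-inj i) D)

  _τ←_ : ∀ {N} → Process C N → Process C N → Set
  P′ τ← P = P —[ τ ]→ P′

  -- Classically an inaccessible process has an inaccessible τ-successor, and following these yields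
  -- a divergence. Excluded middle decides the existential itself and so supplies each successor as
  -- a witness, from which `path` is built by recursion.
  ¬diverges⇒acc : ExcludedMiddle 0ℓ → ∀ {N} {P : Process C N} → ¬ Diverges P → Acc _τ←_ P
  ¬diverges⇒acc em {N} {P} ¬D with em {Acc _τ←_ P}
  ... | yes a = a
  ... | no ¬a = ⊥-elim (¬D (τ^ω (proj₁ ∘ path) refl λ n → proj₁ (proj₂ (next (path n)))))
    where
    Bad : Set
    Bad = ∃ λ (Q : Process C N) → ¬ Acc _τ←_ Q

    next : (b : Bad) → ∃ λ Q′ → proj₁ b —[ τ ]→ Q′ × ¬ Acc _τ←_ Q′
    next (Q , ¬a) with em {∃ λ Q′ → Q —[ τ ]→ Q′ × ¬ Acc _τ←_ Q′}
    ... | yes b = b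
    ... | no ¬b = ⊥-elim (¬a (acc λ {Q′} d → decidable-stable em λ ¬a′ → ¬b (Q′ , d , ¬a′)))

    path : ℕ → Bad
    path zero    = P , ¬a
    path (suc n) with next (path n)
    ... | Q′ , _ , ¬a′ = Q′ , ¬a′

-- The ternary relation and its transitions.

module Comparison (𝒮 : Sorting) {C : Calculus.Signature 𝒮}
  (def : ∀ {σ} → C σ → Calculus.Abstraction 𝒮 C (Calculus.∅ 𝒮) σ)
  (ℰ : Calculus.System 𝒮 C) {N : Calculus.Names 𝒮}
  (F G : Calculus.Solutions.Family 𝒮 def ℰ N) where
  open Sorting 𝒮
  open Calculus 𝒮
  open System ℰ
  open Solutions def ℰ
  open Renaming 𝒮
  open Transitions 𝒮 def⁺

  -- P, Q and R arise from one term by replacing its variables by F, K and G; at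
  -- index true, every variable is guarded.  In the case var, injectivity of the
  -- instantiation says that the arguments are distinct and not free in F and G.
  data Rel {M : Names} : Bool → (P Q R : Process C⁺ M) → Set where
    same : ∀ {g P} → Rel g P P P
    pre  : ∀ {g s p} {a : M s} {P Q R} → Rel false P Q R → Rel g (pre p a P) (pre p a Q) (pre p a R)
    ν    : ∀ {g s P Q R} → Rel g P Q R → Rel g (ν s P) (ν s Q) (ν s R)
    _∥_  : ∀ {g P Q R P′ Q′ R′} → Rel g P Q R → Rel g P′ Q′ R′ → Rel g (P ∥ P′) (Q ∥ Q′) (R ∥ R′)
    !inp : ∀ {g s} {a : M s} {P Q R} → Rel false P Q R → Rel g (!inp a P) (!inp a Q) (!inp a R)
    abs  : ∀ {g σ P Q R} {ã : Tuple M σ} → Rel g (P ⟦ ã ⟧) (Q ⟦ ã ⟧) (R ⟦ ã ⟧) →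
           Rel g (abs P ⟨ ã ⟩) (abs Q ⟨ ã ⟩) (abs R ⟨ ã ⟩)
    absᵠ : ∀ {g σ P Q R} {ã : Tuple M σ} → Rel g P (Q ⟦ ã ⟧) R → Rel g P (abs Q ⟨ ã ⟩) R
    conᵠ : ∀ {g σ P R} {k : C⁺ σ} {ã : Tuple M σ} → Rel g P (renᴬ closed (def⁺ k) ⟨ ã ⟩) R →
           Rel g P (con k ⟨ ã ⟩) R
    var  : ∀ {σ} (x : Var σ) {θ : N ⇒ M} {ã : Tuple M σ} → Inj (inst θ ã) →
           Rel false (renᴬ θ (F x) ⟨ ã ⟩) (con (inj₂ x) ⟨ ã ⟩) (renᴬ θ (G x) ⟨ ã ⟩)

  rel-cast : ∀ {M g} {P P′ Q Q′ R R′ : Process C⁺ M} → P ≡ P′ → Q ≡ Q′ → R ≡ R′ →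
             Rel g P Q R → Rel g P′ Q′ R′
  rel-cast refl refl refl r = r

  rel-relax : ∀ {M g} {P Q R : Process C⁺ M} → Rel g P Q R → Rel false P Q R
  rel-relax same      = same
  rel-relax (pre r)   = pre r
  rel-relax (ν r)     = ν (rel-relax r)
  rel-relax (r ∥ r′)  = rel-relax r ∥ rel-relax r′
  rel-relax (!inp r)  = !inp r
  rel-relax (abs r)   = abs (rel-relax r)
  rel-relax (absᵠ r)  = absᵠ (rel-relax r)
  rel-relax (conᵠ r)  = conᵠ (rel-relax r)
  rel-relax (var x i) = var x i

  -- Injectivity of `ρ` is used at `var`, where it composes with that of the instantiation.
  rel-ren : ∀ {M L g} {ρ : M ⇒ L} → Inj ρ → ∀ {P Q R} → Rel g P Q R →
            Rel g (ren ρ P) (ren ρ Q) (ren ρ R)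
  rel-ren i same     = same
  rel-ren i (pre r)  = pre (rel-ren (lift-inj i) r)
  rel-ren i (ν r)    = ν (rel-ren (lift-inj i) r)
  rel-ren i (r ∥ r′) = rel-ren i r ∥ rel-ren i r′
  rel-ren i (!inp r) = !inp (rel-ren (lift-inj i) r)
  rel-ren {ρ = ρ} i (abs {P = P} {Q} {R} {ã} r) =
    abs (rel-cast (ren-⟦⟧ ρ P ã) (ren-⟦⟧ ρ Q ã) (ren-⟦⟧ ρ R ã) (rel-ren i r))
  rel-ren {ρ = ρ} i (absᵠ {Q = Q} {ã = ã} r) = absᵠ (rel-cast refl (ren-⟦⟧ ρ Q ã) refl (rel-ren i r))
  rel-ren {ρ = ρ} i (conᵠ {k = k} {ã} r) = conᵠ (rel-cast refl (ren-def ρ k ã) refl (rel-ren i r))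
  rel-ren {ρ = ρ} i (var x {θ} {ã} j) =
    rel-cast (cong (_⟨ mapᵀ ρ ã ⟩) (sym (renᴬ-⊙ (λ _ _ → refl) (F x)))) refl
             (cong (_⟨ mapᵀ ρ ã ⟩) (sym (renᴬ-⊙ (λ _ _ → refl) (G x))))
      (var x {λ s → ρ s ∘ θ s} (λ s {a} {b} e →
        j s (i s (trans (inst-∘ s a) (trans e (sym (inst-∘ s b)))))))
    where inst-∘ = inst-⊙ {ρ = ρ} {θ} (λ _ _ → refl) ã

  rel-weaken : ∀ {M g} (μ : Action M) {P Q R} → Rel g P Q R → Rel false (weaken μ P) (weaken μ Q) (weaken μ R)
  rel-weaken τ         r = rel-relax r
  rel-weaken (act p a) r = rel-ren (wk-inj (λ _ e → e)) (rel-relax r)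

  rel-νs : ∀ {M g} σ {P Q R : Process C⁺ (M ⊕ σ)} → Rel g P Q R → Rel g (νs σ P) (νs σ Q) (νs σ R)
  rel-νs []      r = rel-ren (inst-inj [] (λ _ e → e) (λ ()) (λ _ ())) r
  rel-νs (s ∷ σ) {P} {Q} {R} r =
    rel-cast (sym (νs-∷ s σ P)) (sym (νs-∷ s σ Q)) (sym (νs-∷ s σ R)) (ν (rel-νs σ (rel-ren extrude-inj r)))

  -- At index `true` there is no `var`, so steps come from prefixes common to all three, and `Q` and
  -- `R` answer with one strong step each. Bodies of prefixes may expose variables, hence `false`
  -- for the residuals.
  rel-step : ∀ {M} {P Q R : Process C⁺ M} {μ P′} → Rel true P Q R → P —[ μ ]→ P′ →
             ∃₂ λ Q′ R′ → Q —[ μ ]→ Q′ × R —[ μ ]→ R′ × Rel false P′ Q′ R′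
  rel-step same d = _ , _ , d , d , same
  rel-step (pre r) pre = _ , _ , pre , pre , r
  rel-step (ν r) (resτ d) with rel-step r d
  ... | _ , _ , e , f , r′ = _ , _ , resτ e , resτ f , ν r′
  rel-step (ν r) (res d) with rel-step r d
  ... | _ , _ , e , f , r′ = _ , _ , res e , res f , ν (rel-ren exchange-inj r′)
  rel-step {μ = μ} (r ∥ s) (parˡ d) with rel-step r d
  ... | _ , _ , e , f , r′ = _ , _ , parˡ e , parˡ f , r′ ∥ rel-weaken μ s
  rel-step {μ = μ} (r ∥ s) (parʳ d) with rel-step s d
  ... | _ , _ , e , f , s′ = _ , _ , parʳ e , parʳ f , rel-weaken μ r ∥ s′
  rel-step (r ∥ s) (comˡ d₁ d₂) with rel-step r d₁ | rel-step s d₂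
  ... | _ , _ , e₁ , f₁ , r′ | _ , _ , e₂ , f₂ , s′ = _ , _ , comˡ e₁ e₂ , comˡ f₁ f₂ , rel-νs _ (r′ ∥ s′)
  rel-step (r ∥ s) (comʳ d₁ d₂) with rel-step r d₁ | rel-step s d₂
  ... | _ , _ , e₁ , f₁ , r′ | _ , _ , e₂ , f₂ , s′ = _ , _ , comʳ e₁ e₂ , comʳ f₁ f₂ , rel-νs _ (r′ ∥ s′)
  rel-step (!inp r) rep = _ , _ , rep , rep , (r ∥ rel-ren (wk-inj (λ _ e → e)) (!inp r))
  rel-step (abs r) (abs d) with rel-step r d
  ... | _ , _ , e , f , r′ = _ , _ , abs e , abs f , r′
  rel-step (absᵠ r) d with rel-step r d
  ... | _ , _ , e , f , r′ = _ , _ , abs e , f , r′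
  rel-step (conᵠ r) d with rel-step r d
  ... | _ , _ , e , f , r′ = _ , _ , con e , f , r′

  -- Fillings of one term are related.

  Filled : ∀ {L M} → Bool → L ⇒ M → N ⇒ M → ∅ ⇒ M → Term C Var L → Set
  Filled g χ θ κ T =
    Rel g (fill inj₁ F θ (ren χ T)) (fill inj₁ K κ (ren χ T)) (fill inj₁ G θ (ren χ T))

  private
    lift-disjoint : ∀ {L M σ} {χ : L ⇒ M} {θ : N ⇒ M} → Disjoint χ θ → Disjoint (lift {σ = σ} χ) (wk θ)
    lift-disjoint n s (inj₁ a) b e = n s a b (inj₁-injective e)

    inst-disjoint : ∀ {L M σ} {χ : L ⇒ M} {θ : N ⇒ M} → Disjoint χ θ → (ã : Tuple L σ) →
                    Disjoint (inst χ (mapᵀ χ ã)) θ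
    inst-disjoint n ã s (inj₁ a) b e = n s a b e
    inst-disjoint n ã s (inj₂ p) b e = n s (All.lookup ã p) b (trans (sym (lookup-map ã p)) e)

  -- By `ren-fill` the contraction passes through the filling, so the arguments end up in `χ`. The
  -- recursion in `filled` thereby stays structural in the unrenamed body `P`.
  filled-abs : ∀ {L M σ g} {χ : L ⇒ M} {θ : N ⇒ M} {κ : ∅ ⇒ M} (P : Term C Var (L ⊕ σ)) (ã : Tuple L σ) →
               Filled g (inst χ (mapᵀ χ ã)) θ κ P → Filled g χ θ κ (abs P ⟨ ã ⟩)
  filled-abs {χ = χ} P ã r = abs (rel-cast (eq F _ (λ _ _ → refl)) (eq K _ (λ _ ())) (eq G _ (λ _ _ → refl)) r)
    where
    b̃ = mapᵀ χ ã
    eq : ∀ {N′} (H : Family N′) (θ : N′ ⇒ _) {θ′ : N′ ⇒ _} → inst idʳ b̃ ⊙ θ′ ≐ θ →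
         fill inj₁ H θ (ren (inst χ b̃) P) ≡ fill inj₁ H θ′ (ren (lift χ) P) ⟦ b̃ ⟧
    eq H θ h = sym (trans (ren-fill h (ren (lift χ) P))
      (cong (fill inj₁ H θ) (ren-⊙ (inst-lift (λ _ _ → refl) b̃) P)))

  -- At a variable, `d` makes the arguments distinct and `n` keeps them away from the free names of
  -- `F` and `G`; together with `i` this is the injectivity that `var` asks for.
  filled : ∀ {L M} {χ : L ⇒ M} {θ : N ⇒ M} {κ : ∅ ⇒ M} → Inj θ → Disjoint χ θ → (T : Term C Var L) →
           DistinctIn χ T → Filled false χ θ κ T
  filled i n 𝟘             d       = same
  filled i n (pre p a T)   d       = pre (filled (wk-inj i) (lift-disjoint n) T d)
  filled i n (ν s T)       d       = ν (filled (wk-inj i) (lift-disjoint n) T d)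
  filled i n (T ∥ U)       (d , e) = filled i n T d ∥ filled i n U e
  filled i n (!inp a T)    d       = !inp (filled (wk-inj i) (lift-disjoint n) T d)
  filled i n (abs P ⟨ ã ⟩) (_ , d) = filled-abs P ã (filled i (inst-disjoint n ã) P d)
  filled i n (con k ⟨ ã ⟩) d       = same
  filled i n (var x ⟨ ã ⟩) (d , _) = var x (inst-inj (mapᵀ _ ã) i d λ s p → inst-disjoint n ã s (inj₂ p))

  filled-guarded : ∀ {L M} {χ : L ⇒ M} {θ : N ⇒ M} {κ : ∅ ⇒ M} → Inj θ → Disjoint χ θ →
                   {T : Term C Var L} → Guarded T → DistinctIn χ T → Filled true χ θ κ T
  filled-guarded i n 𝟘       d       = same
  filled-guarded i n {pre _ _ T} pre d = pre (filled (wk-inj i) (lift-disjoint n) T d)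
  filled-guarded i n (ν g)   d       = ν (filled-guarded (wk-inj i) (lift-disjoint n) g d)
  filled-guarded i n (g ∥ h) (d , e) = filled-guarded i n g d ∥ filled-guarded i n h e
  filled-guarded i n { !inp _ T} !inp d = !inp (filled (wk-inj i) (lift-disjoint n) T d)
  filled-guarded i n {abs P ⟨ ã ⟩} (app (abs g)) (_ , d) =
    filled-abs P ã (filled-guarded i (inst-disjoint n ã) g d)
  filled-guarded i n (app con) d     = same

  E-filled : ∀ {M N′ σ} (x : Var σ) (H : Family N′) (θ : N′ ⇒ M) (ã : Tuple M σ) →
             fill inj₁ H θ (ren (inst closed ã) (applyFresh (rhs x))) ≡ renᴬ θ (E x [ H ]) ⟨ ã ⟩
  E-filled x H θ ã = trans (cong (fill inj₁ H θ) (ren-applyFresh closed ã (rhs x)))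
    (cong (_⟨ ã ⟩) (trans (cong (fillᴬ inj₁ H θ) (sym (renᴬ-⊙ (λ _ ()) (rhs x))))
      (sym (renᴬ-fillᴬ (λ _ _ → refl) (renᴬ closed (rhs x))))))

  -- Injectivity of `inst θ ã` is an invariant that survives unfolding. It makes `θ` injective, the
  -- arguments distinct and the two disjoint, which is what `filled-guarded` needs to reestablish it
  -- at the variables of the right-hand side.
  rel-rhs : ∀ {M σ} (x : Var σ) → Guardedᴬ (rhs x) → {θ : N ⇒ M} {ã : Tuple M σ} → Inj (inst θ ã) →
            Rel true (renᴬ θ (E x [ F ]) ⟨ ã ⟩) (renᴬ closed (E x [ K ]) ⟨ ã ⟩) (renᴬ θ (E x [ G ]) ⟨ ã ⟩)
  rel-rhs x g {θ} {ã} i =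
    rel-cast (E-filled x F θ ã) (E-filled x K closed ã) (E-filled x G θ ã)
      (filled-guarded θ-inj disjoint (app (guardedᴬ-ren _ g))
        (distinct-inj {ζ = inst closed ã} χ-inj (λ _ _ → refl) (applyFresh (rhs x)) (wellFormed x)))
    where
    θ-inj : Inj θ
    θ-inj s e = inj₁-injective (i s e)

    χ-inj : Inj (inst closed ã)
    χ-inj s {inj₂ p} {inj₂ q} e = cong inj₂ (inj₂-injective (i s {inj₂ p} {inj₂ q} e))

    disjoint : Disjoint (inst closed ã) θ
    disjoint s (inj₂ p) b e with i s {inj₂ p} {inj₁ b} e
    ... | ()

  -- Unfolding of unguarded variables, and the induction.

  module _ (guarded : IsGuarded ℰ) (post : PostFixed F) (pref : PreFixed G) where

    -- The middle component is left as it is: its unfoldings are recorded by conᵠ.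
    rel-unfold : ∀ {M} {P Q R : Process C⁺ M} → Rel false P Q R →
                 ∃₂ λ P̂ R̂ → Rel true P̂ Q R̂ × P ⊑ P̂ × R̂ ⊑ R
    rel-unfold same     = _ , _ , same , (λ _ w → w) , (λ _ w → w)
    rel-unfold (pre r)  = _ , _ , pre r , (λ _ w → w) , (λ _ w → w)
    rel-unfold (ν r) with rel-unfold r
    ... | _ , _ , r̂ , l , u = _ , _ , ν r̂ , ⊑-ν l , ⊑-ν u
    rel-unfold (r ∥ s) with rel-unfold r | rel-unfold s
    ... | _ , _ , r̂ , l , u | _ , _ , ŝ , l′ , u′ = _ , _ , r̂ ∥ ŝ , ⊑-∥ l l′ , ⊑-∥ u u′
    rel-unfold (!inp r) = _ , _ , !inp r , (λ _ w → w) , (λ _ w → w)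
    -- The unfolded outer processes need not be of the form `P ⟦ ã ⟧`, so they are kept contracted,
    -- which does not affect traces; only the middle stays an application.
    rel-unfold (abs r) with rel-unfold r
    ... | _ , _ , r̂ , l , u = _ , _ , absᵠ r̂ ,
      (λ t w → l t (steps⇒⊑ (λ { (abs d) → d }) t w)) , (λ t w → steps⇒⊑ abs t (u t w))
    rel-unfold (absᵠ r) with rel-unfold r
    ... | _ , _ , r̂ , l , u = _ , _ , absᵠ r̂ , l , u
    rel-unfold (conᵠ r) with rel-unfold r
    ... | _ , _ , r̂ , l , u = _ , _ , conᵠ r̂ , l , u
    -- Both fixed-point hypotheses are moved from fresh arguments to `ã` by the injective renaming
    -- `inst θ ã`.
    rel-unfold (var x {θ} {ã} i) = _ , _ , conᵠ (rel-rhs x (guarded x) i) ,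
      subst₂ _⊑_ (ren-applyFresh θ ã (F x)) (ren-applyFresh θ ã (E x [ F ])) (⊑-ren i (post x)) ,
      subst₂ _⊑_ (ren-applyFresh θ ã (E x [ G ])) (ren-applyFresh θ ã (G x)) (⊑-ren i (pref x))

    module _ (em : ExcludedMiddle 0ℓ) where
      mutual
        -- The order is lexicographic in `t` and the accessibility of `Q`: each τ-step of the
        -- unfolded `P` costs one of `Q`. The run length is no measure, since unfolding may lengthen
        -- a run. After a visible action accessibility is derived anew for the residual, which is
        -- why `¬ Diverges Q` is carried along.
        rel⇒⊑ : ∀ {M} (t : Trace M) {P Q R : Process C⁺ M} → ¬ Diverges Q → Acc _τ←_ Q →
                Rel false P Q R → P ⟹⟨ t ⟩ → R ⟹⟨ t ⟩
        rel⇒⊑ t ¬D a r w with rel-unfold r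
        ... | _ , _ , r̂ , l , u = u t (rel-run t ¬D a r̂ (proj₂ (weak⇒run t (l t w))))

        rel-run : ∀ {M n} (t : Trace M) {P Q R : Process C⁺ M} → ¬ Diverges Q → Acc _τ←_ Q →
                  Rel true P Q R → Run n P t → R ⟹⟨ t ⟩
        rel-run ε           ¬D a       r done = tt
        rel-run t           ¬D (acc a) r (tau d ds) with rel-step r d
        ... | _ , _ , e , f , r′ = run⇒weak (tau f (proj₂ (weak⇒run t
                (rel⇒⊑ t (¬D ∘ step e) (a e) r′ (run⇒weak ds)))))
        rel-run (_ · _ ∷ t) ¬D a       r (vis d ds) with rel-step r d
        ... | _ , _ , e , f , r′ = run⇒weak (vis f (proj₂ (weak⇒run t
                (rel⇒⊑ t (¬D ∘ step e) (¬diverges⇒acc em (¬D ∘ step e)) r′ (run⇒weak ds)))))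

theorem6p6 : ExcludedMiddle 0ℓ →
    (𝒮 : Sorting) → let open Calculus 𝒮 in
    (C : Signature) (def : ∀ {σ} → C σ → Abstraction C ∅ σ) →
    (∀ {σ} (k : C σ) → WellFormed (def k)) →
    (ℰ : System C) → let open System ℰ in let open Solutions def ℰ in
    IsGuarded ℰ →
    DivergenceFree →
    {N : Names} (F G : Family N) →
    (∀ {σ} (x : Var σ) → WellFormed (F x)) →
    (∀ {σ} (x : Var σ) → WellFormed (G x)) →
    PostFixed F →
    PreFixed G →
    ∀ {σ} (x : Var σ) → F x ⊑ᴬ G x
theorem6p6 em 𝒮 C def _ ℰ guarded convergent {N} F G _ _ post pref {σ} x t =
  -- At fresh arguments the instantiation is the identity, hence injective, so `var` relates `F x`,
  -- `K x` and `G x`.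
  rel⇒⊑ guarded post pref em t ¬D (¬diverges⇒acc em ¬D) (var x (retract⇒inj idʳ inst-fresh))
  where
  open Calculus 𝒮
  open Solutions def ℰ
  open Renaming 𝒮
  open Transitions 𝒮 def⁺
  open Comparison 𝒮 def ℰ F G

  fresh : Tuple (N ⊕ σ) σ
  fresh = All.tabulate inj₂

  inst-fresh : idʳ ⊙ inst (wk idʳ) fresh ≐ idʳ
  inst-fresh _ (inj₁ a) = refl
  inst-fresh _ (inj₂ p) = lookup-tabulate inj₂ p

  -- `DivergenceFree` concerns `K x` over `∅ ⊕ σ`; the injective renaming `lift closed` takes it to
  -- the scope `N ⊕ σ`.
  Kx : ren (lift closed) (applyFresh (K x)) ≡ con (inj₂ x) ⟨ fresh ⟩
  Kx = cong (con (inj₂ x) ⟨_⟩) (mapᵀ-tabulate fresh (λ p → sym (lookup-tabulate inj₂ p)))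

  ¬D : ¬ Diverges (con (inj₂ x) ⟨ fresh ⟩)
  ¬D D = convergent x (diverges-unren (lift-inj (λ _ {})) (subst Diverges (sym Kx) D))
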